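{- If $G$ is a $C_{4k}$-free bipartite graph, then the following are equivalent: (1) $G$ has a perfect matching; (2) the adjacency matrix $A(G)$ is nonsingular; (3) $G=C_N(G)$.
   Context: All graphs are finite, simple and undirected. A graph is a $C_{4k}$-free bipartite graph if it is bipartite and contains no cycle whose length is a multiple of $4$. For a graph $G$, $\operatorname{Null}(G)$ is the null space of $A(G)$, viewed as a subspace of $\mathbb{R}^{V(G)}$; $\operatorname{Supp}(G)$ is the set of vertices $v$ with $\vec{x}_v\neq0$ for some $\vec{x}\in\operatorname{Null}(G)$; $\operatorname{Core}(G)$ is the set of vertices adjacent to some vertex of $\operatorname{Supp}(G)$; $\operatorname{Npart}(G)=V(G)\setminus(\operatorname{Supp}(G)\cup\operatorname{Core}(G))$. $C_N(G)$ is the subgraph of $G$ induced by $\operatorname{Npart}(G)$.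
   Formalization: The null space Null(G) is taken over ℚ instead of ℝ, so nonsingularity of A(G) and the sets Supp(G), Core(G) and Npart(G) are defined through rational vectors. -}

module Defs where

open import Data.Nat using (ℕ; zero; suc; _∸_; _≥_; _*_)
open import Data.Fin using (Fin; toℕ) renaming (zero to fzero; suc to fsuc)
open import Data.Bool using (Bool; true; false; if_then_else_)
open import Data.Product using (Σ; _×_; ∃)
open import Data.Rational using (ℚ; 0ℚ; 1ℚ; _+_) renaming (_*_ to _*ℚ_)
open import Relation.Binary.PropositionalEquality using (_≡_)
open import Relation.Nullary using (¬_)
open import Function.Definitions using (Injective)

-- A finite simple graph on the vertex set Fin n.
record SimpleGraph (n : ℕ) : Set where
  field
    adj    : Fin n → Fin n → Bool
    sym    : ∀ u v → adj u v ≡ adj v u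
    irrefl : ∀ v → adj v v ≡ false

open SimpleGraph public

module _ {n : ℕ} (G : SimpleGraph n) where

  Edge : Fin n → Fin n → Set
  Edge u v = adj G u v ≡ true

  -- Bipartite: a 2-colouring with adjacent vertices coloured differently.
  Bipartite : Set
  Bipartite = Σ (Fin n → Bool) λ c → ∀ u v → Edge u v → ¬ (c u ≡ c v)

  -- A cycle of length L ≥ 3: distinct vertices f 0, …, f (L-1) with
  -- f i ~ f (i+1) and f (L-1) ~ f 0.
  HasCycleOfLength : ℕ → Set
  HasCycleOfLength L =
    L ≥ 3 × Σ (Fin L → Fin n) λ f →
      Injective _≡_ _≡_ f
      × (∀ (i j : Fin L) → suc (toℕ i) ≡ toℕ j → Edge (f i) (f j))
      × (∀ (i j : Fin L) → toℕ i ≡ L ∸ 1 → toℕ j ≡ 0 → Edge (f i) (f j))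

  -- No cycle whose length is a (positive) multiple of 4.
  C4kFree : Set
  C4kFree = ∀ (k : ℕ) → k ≥ 1 → ¬ HasCycleOfLength (4 * k)

  C4kFreeBipartite : Set
  C4kFreeBipartite = Bipartite × C4kFree

  -- Perfect matching, encoded as a fixed-point-free involution along edges
  -- (the matching edges are {v, m v}).
  HasPerfectMatching : Set
  HasPerfectMatching = Σ (Fin n → Fin n) λ m →
    (∀ v → Edge v (m v)) × (∀ v → m (m v) ≡ v)

-- Finite sum over Fin n.
sumFin : ∀ {n} → (Fin n → ℚ) → ℚ
sumFin {zero}  f = 0ℚ
sumFin {suc n} f = f fzero + sumFin (λ i → f (fsuc i))

module _ {n : ℕ} (G : SimpleGraph n) where

  -- Adjacency matrix A(G) with rational entries.
  A : Fin n → Fin n → ℚ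
  A u v = if adj G u v then 1ℚ else 0ℚ

  -- x ∈ Null(G)  iff  A(G) x = 0.
  InNull : (Fin n → ℚ) → Set
  InNull x = ∀ u → sumFin (λ v → A u v *ℚ x v) ≡ 0ℚ

  -- A(G) nonsingular: Null(G) = {0}.
  Nonsingular : Set
  Nonsingular = ∀ x → InNull x → ∀ v → x v ≡ 0ℚ

  InSupp : Fin n → Set
  InSupp v = ∃ λ x → InNull x × ¬ (x v ≡ 0ℚ)

  InCore : Fin n → Set
  InCore v = ∃ λ u → InSupp u × Edge G u v

  InNpart : Fin n → Set
  InNpart v = ¬ InSupp v × ¬ InCore v

  -- G = C_N(G): every vertex lies in Npart(G).
  EqualsCN : Set
  EqualsCN = ∀ v → InNpart v

{-# OPTIONS --safe #-}
-- Perfect matching ⇒ nonsingular. Let m be a perfect matching and x a null vector with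
-- x v₀ ≠ 0. Row m v of A x = 0 says that x sums to 0 over the neighbours of m v, so if x v has
-- a sign, some neighbour w of m v carries the opposite one. Iterating gives a walk v₀, v₁, …
-- with vᵢ₊₁ ~ m vᵢ along which the sign of x alternates. At its first repetition vᵢ = vᵢ₊d,
-- the vertices vᵢ, m vᵢ, …, vᵢ₊d₋₁, m vᵢ₊d₋₁ form a cycle of length 2d (the vⱼ share one colour,
-- their partners have the other), and d is even because the repeated vertex has one sign.
--
-- Nonsingular ⇒ perfect matching. A nonsingular M has a transversal σ (all M i (σ i) ≠ 0):
-- in a row r with a nonzero entry choose j with M r j ≠ 0 and nonsingular (r, j)-minor, and
-- recurse. Such j exists: a singular (r, j)-minor yields w with w j = 0 and M w a nonzero
-- multiple of eᵣ, and all such w are proportional; the first one has w j₂ ≠ 0 for some j₂ with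
-- M r j₂ ≠ 0, so the (r, j₂)-minor is nonsingular. This runs under double negation, which is
-- harmless since having a perfect matching is decidable. In a bipartite graph, σ on one colour
-- class and σ⁻¹ on the other form a perfect matching.
--
-- Finally, A(G) is nonsingular iff Supp(G) is empty, which is exactly G = C_N(G).
module Submission where

open import Defs
open import Data.Nat using (ℕ)
open import Data.Product using (_×_)
open import Function.Bundles using (_⇔_)
open import Data.Product using (_,_)
open import Function.Bundles using (mk⇔)

module FiniteSums where

  open import Data.Nat using (zero; suc)
  open import Data.Fin using (Fin; punchIn) renaming (zero to fzero; suc to fsuc)
  open import Data.Fin.Properties using (any?)
  open import Data.Product using (_,_; ∃)
  open import Data.Rational using (ℚ; 0ℚ; _+_; _*_; _-_; _<_; _≤_)
  open import Data.Rational.Properties using (_≟_; ≤-refl; +-mono-≤; +-mono-<-≤; +-mono-≤-<)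
  open import Data.Rational.Solver using (module +-*-Solver)
  open import Function using (_∘_)
  open import Relation.Binary.PropositionalEquality
    using (_≡_; _≢_; _≗_; refl; cong; cong₂; trans)
  open import Relation.Nullary using (yes; no; ¬?; contradiction)
  open import Relation.Nullary.Decidable using (decidable-stable)
  open +-*-Solver

  sumFin-cong : ∀ {n} {f g : Fin n → ℚ} → f ≗ g → sumFin f ≡ sumFin g
  sumFin-cong {zero}  f≗g = refl
  sumFin-cong {suc n} f≗g = cong₂ _+_ (f≗g fzero) (sumFin-cong (f≗g ∘ fsuc))

  sumFin-zero : ∀ {n} {f : Fin n → ℚ} → (∀ i → f i ≡ 0ℚ) → sumFin f ≡ 0ℚ
  sumFin-zero {zero}  f≡0 = refl
  sumFin-zero {suc n} f≡0 = cong₂ _+_ (f≡0 fzero) (sumFin-zero (f≡0 ∘ fsuc))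

  sumFin≢0⇒nonzeroTerm : ∀ {n} (f : Fin n → ℚ) → sumFin f ≢ 0ℚ → ∃ λ i → f i ≢ 0ℚ
  sumFin≢0⇒nonzeroTerm f Σf≢0 with any? (λ i → ¬? (f i ≟ 0ℚ))
  ... | yes found = found
  ... | no  none  = contradiction (sumFin-zero f≡0) Σf≢0
    where
    f≡0 : ∀ i → f i ≡ 0ℚ
    f≡0 i = decidable-stable (f i ≟ 0ℚ) λ fi≢0 → none (i , fi≢0)

  sumFin-punchIn : ∀ {n} (j : Fin (suc n)) (f : Fin (suc n) → ℚ) →
                   sumFin f ≡ f j + sumFin (f ∘ punchIn j)
  sumFin-punchIn fzero f = refl
  sumFin-punchIn {suc n} (fsuc j) f =
    trans (cong (f fzero +_) (sumFin-punchIn j (f ∘ fsuc)))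
          (solve 3 (λ a b c → a :+ (b :+ c) := b :+ (a :+ c)) refl
                 (f fzero) (f (fsuc j)) (sumFin (f ∘ fsuc ∘ punchIn j)))

  sumFin-linear : ∀ {n} a b (f g : Fin n → ℚ) →
                  sumFin (λ i → a * f i - b * g i) ≡ a * sumFin f - b * sumFin g
  sumFin-linear {zero} a b f g = solve 2 (λ a b → con 0ℚ := a :* con 0ℚ :- b :* con 0ℚ) refl a b
  sumFin-linear {suc n} a b f g =
    trans (cong (a * f fzero - b * g fzero +_) (sumFin-linear a b (f ∘ fsuc) (g ∘ fsuc)))
          (solve 6 (λ a b x y F G → (a :* x :- b :* y) :+ (a :* F :- b :* G)
                                     := a :* (x :+ F) :- b :* (y :+ G)) refl
                 a b (f fzero) (g fzero) (sumFin (f ∘ fsuc)) (sumFin (g ∘ fsuc)))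

  sumFin-nonneg : ∀ {n} {f : Fin n → ℚ} → (∀ i → 0ℚ ≤ f i) → 0ℚ ≤ sumFin f
  sumFin-nonneg {zero}  f≥0 = ≤-refl
  sumFin-nonneg {suc n} f≥0 = +-mono-≤ (f≥0 fzero) (sumFin-nonneg (f≥0 ∘ fsuc))

  sumFin-pos : ∀ {n} {f : Fin n → ℚ} → (∀ i → 0ℚ ≤ f i) → ∀ i → 0ℚ < f i → 0ℚ < sumFin f
  sumFin-pos f≥0 fzero    fi>0 = +-mono-<-≤ fi>0 (sumFin-nonneg (f≥0 ∘ fsuc))
  sumFin-pos f≥0 (fsuc i) fi>0 = +-mono-≤-< (f≥0 fzero) (sumFin-pos (f≥0 ∘ fsuc) i fi>0)

  sumFin-nonpos : ∀ {n} {f : Fin n → ℚ} → (∀ i → f i ≤ 0ℚ) → sumFin f ≤ 0ℚ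
  sumFin-nonpos {zero}  f≤0 = ≤-refl
  sumFin-nonpos {suc n} f≤0 = +-mono-≤ (f≤0 fzero) (sumFin-nonpos (f≤0 ∘ fsuc))

  sumFin-neg : ∀ {n} {f : Fin n → ℚ} → (∀ i → f i ≤ 0ℚ) → ∀ i → f i < 0ℚ → sumFin f < 0ℚ
  sumFin-neg f≤0 fzero    fi<0 = +-mono-<-≤ fi<0 (sumFin-nonpos (f≤0 ∘ fsuc))
  sumFin-neg f≤0 (fsuc i) fi<0 = +-mono-≤-< (f≤0 fzero) (sumFin-neg (f≤0 ∘ fsuc) i fi<0)

module Signs where

  open import Data.Fin using (Fin)
  open import Data.Fin.Properties using (any?)
  open import Data.Product using (_,_; ∃)
  open import Data.Rational using (ℚ; 0ℚ; _<_)
  open import Data.Rational.Properties using (_<?_; <-cmp; <-asym; <-irrefl; ≮⇒≥)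
  open import Data.Sign as Sign using (Sign; opposite)
  open import Function using (_∘_)
  open import Relation.Binary using (tri<; tri≈; tri>)
  open import Relation.Binary.PropositionalEquality using (_≡_; _≢_; refl; subst)
  open import Relation.Nullary using (¬_; Dec; yes; no; contradiction)
  open FiniteSums using (sumFin-pos; sumFin-neg)

  HasSign : Sign → ℚ → Set
  HasSign Sign.+ q = 0ℚ < q
  HasSign Sign.- q = q < 0ℚ

  hasSign? : ∀ σ q → Dec (HasSign σ q)
  hasSign? Sign.+ q = 0ℚ <? q
  hasSign? Sign.- q = q <? 0ℚ

  ¬hasSign-0 : ∀ σ → ¬ HasSign σ 0ℚ
  ¬hasSign-0 Sign.+ = <-irrefl refl
  ¬hasSign-0 Sign.- = <-irrefl refl

  hasSign-functional : ∀ {σ τ q} → HasSign σ q → HasSign τ q → σ ≡ τ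
  hasSign-functional {Sign.+} {Sign.+} _ _ = refl
  hasSign-functional {Sign.-} {Sign.-} _ _ = refl
  hasSign-functional {Sign.+} {Sign.-} q>0 q<0 = contradiction q<0 (<-asym q>0)
  hasSign-functional {Sign.-} {Sign.+} q<0 q>0 = contradiction q<0 (<-asym q>0)

  ≢0⇒hasSign : ∀ {q} → q ≢ 0ℚ → ∃ λ σ → HasSign σ q
  ≢0⇒hasSign {q} q≢0 with <-cmp q 0ℚ
  ... | tri< q<0 _ _ = Sign.- , q<0
  ... | tri≈ _ q≡0 _ = contradiction q≡0 q≢0
  ... | tri> _ _ q>0 = Sign.+ , q>0

  sumFin-hasSign : ∀ {n} σ {f : Fin n → ℚ} → (∀ j → ¬ HasSign (opposite σ) (f j)) →
                   ∀ i → HasSign σ (f i) → HasSign σ (sumFin f)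
  sumFin-hasSign Sign.+ weak = sumFin-pos (≮⇒≥ ∘ weak)
  sumFin-hasSign Sign.- weak = sumFin-neg (≮⇒≥ ∘ weak)

  sumFin≡0⇒oppositeSign : ∀ {n σ} {f : Fin n → ℚ} {i} → sumFin f ≡ 0ℚ → HasSign σ (f i) →
                          ∃ λ j → HasSign (opposite σ) (f j)
  sumFin≡0⇒oppositeSign {σ = σ} {f} {i} Σf≡0 fi with any? (λ j → hasSign? (opposite σ) (f j))
  ... | yes found = found
  ... | no  none  =
    contradiction (subst (HasSign σ) Σf≡0 (sumFin-hasSign σ (λ j s → none (j , s)) i fi)) (¬hasSign-0 σ)

module Matrices where

  open import Data.Nat using (zero; suc)
  open import Data.Fin using (Fin; punchIn; punchOut) renaming (zero to fzero)
  open import Data.Fin.Properties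
    using (any?; punchInᵢ≢i; punchIn-punchOut; punchIn-injective; punchOut-injective)
    renaming (_≟_ to _≟ᶠ_)
  open import Data.Product using (Σ; _×_; _,_; proj₂; ∃; ∃₂)
  open import Data.Rational using (ℚ; 0ℚ; 1ℚ; _+_; _*_; _-_; 1/_; ≢-nonZero)
  open import Data.Rational.Properties
    using (_≟_; *-zeroˡ; *-zeroʳ; *-identityˡ; *-inverseˡ; *-assoc; +-identityˡ)
  open import Data.Rational.Solver using (module +-*-Solver)
  open import Data.Vec.Functional using (insertAt)
  open import Data.Vec.Functional.Properties using (insertAt-lookup; insertAt-punchIn)
  open import Effect.Monad using (RawMonad)
  open import Function using (_∘_)
  open import Level using (0ℓ)
  open import Function.Definitions using (Injective)
  open import Relation.Binary.PropositionalEquality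
    using (_≡_; _≢_; refl; cong; cong₂; trans; subst; module ≡-Reasoning)
    renaming (sym to ≡-sym)
  open import Relation.Nullary using (¬_; Dec; yes; no; ¬?; contradiction)
  open import Relation.Nullary.Decidable using (decidable-stable)
  open import Relation.Nullary.Negation using (¬¬-Monad)
  open RawMonad (¬¬-Monad {0ℓ})
  open FiniteSums
  open +-*-Solver

  Matrix : ℕ → Set
  Matrix n = Fin n → Fin n → ℚ

  infixl 7 _*ᵥ_
  _*ᵥ_ : ∀ {n} → Matrix n → (Fin n → ℚ) → Fin n → ℚ
  (M *ᵥ z) i = sumFin (λ j → M i j * z j)

  TrivialKernel : ∀ {n} → Matrix n → Set
  TrivialKernel M = ∀ z → (∀ i → (M *ᵥ z) i ≡ 0ℚ) → ∀ j → z j ≡ 0ℚ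

  minor : ∀ {n} → Matrix (suc n) → Fin (suc n) → Fin (suc n) → Matrix n
  minor M r j a b = M (punchIn r a) (punchIn j b)

  Transversal : ∀ {n} → Matrix n → Set
  Transversal M = Σ (Fin _ → Fin _) λ σ → Injective _≡_ _≡_ σ × (∀ i → M i (σ i) ≢ 0ℚ)

  p≢0⇒p*q≡0⇒q≡0 : ∀ {p q} → p ≢ 0ℚ → p * q ≡ 0ℚ → q ≡ 0ℚ
  p≢0⇒p*q≡0⇒q≡0 {p} {q} p≢0 pq≡0 = begin
    q                 ≡⟨ ≡-sym (*-identityˡ q) ⟩
    1ℚ * q            ≡⟨ cong (_* q) (≡-sym (*-inverseˡ p)) ⟩
    (1/ p * p) * q    ≡⟨ *-assoc (1/ p) p q ⟩
    1/ p * (p * q)    ≡⟨ cong (1/ p *_) pq≡0 ⟩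
    1/ p * 0ℚ         ≡⟨ *-zeroʳ (1/ p) ⟩
    0ℚ                ∎
    where
    open ≡-Reasoning
    instance _ = ≢-nonZero p≢0

  *ᵥ-linear : ∀ {n} (M : Matrix n) a b u v i →
              (M *ᵥ (λ t → a * u t - b * v t)) i ≡ a * (M *ᵥ u) i - b * (M *ᵥ v) i
  *ᵥ-linear M a b u v i =
    trans (sumFin-cong λ t → solve 5 (λ m a b x y → m :* (a :* x :- b :* y)
                                                   := a :* (m :* x) :- b :* (m :* y)) refl
                                     (M i t) a b (u t) (v t))
          (sumFin-linear a b (λ t → M i t * u t) (λ t → M i t * v t))

  *ᵥ-insertAt : ∀ {n} (M : Matrix (suc n)) r j z a →
                (M *ᵥ insertAt z j 0ℚ) (punchIn r a) ≡ (minor M r j *ᵥ z) a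
  *ᵥ-insertAt M r j z a = begin
    (M *ᵥ insertAt z j 0ℚ) (punchIn r a)
      ≡⟨ sumFin-punchIn j (λ t → M (punchIn r a) t * insertAt z j 0ℚ t) ⟩
    M (punchIn r a) j * insertAt z j 0ℚ j + (minor M r j *ᵥ (insertAt z j 0ℚ ∘ punchIn j)) a
      ≡⟨ cong₂ _+_ (trans (cong (M (punchIn r a) j *_) (insertAt-lookup z j 0ℚ)) (*-zeroʳ (M (punchIn r a) j)))
                   (sumFin-cong λ b → cong (minor M r j a b *_) (insertAt-punchIn z j 0ℚ b)) ⟩
    0ℚ + (minor M r j *ᵥ z) a
      ≡⟨ +-identityˡ _ ⟩
    (minor M r j *ᵥ z) a ∎
    where open ≡-Reasoning

  NontrivialKernel : ∀ {n} → Matrix n → Set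
  NontrivialKernel M = ∃ λ z → (∀ i → (M *ᵥ z) i ≡ 0ℚ) × ∃ λ j → z j ≢ 0ℚ

  ¬trivialKernel⇒¬¬nontrivialKernel : ∀ {n} {M : Matrix n} → ¬ TrivialKernel M → ¬ ¬ NontrivialKernel M
  ¬trivialKernel⇒¬¬nontrivialKernel ¬trivial none =
    ¬trivial λ z Mz≡0 j → decidable-stable (z j ≟ 0ℚ) λ zj≢0 → none (z , Mz≡0 , j , zj≢0)

  module _ {n} (M : Matrix (suc n)) (M-trivial : TrivialKernel M) (r : Fin (suc n)) where

    Isolating : (Fin (suc n) → ℚ) → Set
    Isolating w = (∀ i → i ≢ r → (M *ᵥ w) i ≡ 0ℚ) × (M *ᵥ w) r ≢ 0ℚ

    singularMinor⇒isolating : ∀ {j} → NontrivialKernel (minor M r j) →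
                              ∃ λ w → Isolating w × w j ≡ 0ℚ
    singularMinor⇒isolating {j} (z , Mz≡0 , b , zb≢0) =
      w , (offRow , onRow) , insertAt-lookup z j 0ℚ
      where
      w = insertAt z j 0ℚ

      offRow : ∀ i → i ≢ r → (M *ᵥ w) i ≡ 0ℚ
      offRow i i≢r = subst (λ i → (M *ᵥ w) i ≡ 0ℚ) (punchIn-punchOut (i≢r ∘ ≡-sym))
                           (trans (*ᵥ-insertAt M r j z _) (Mz≡0 _))

      onRow : (M *ᵥ w) r ≢ 0ℚ
      onRow Mwr≡0 = zb≢0 (trans (≡-sym (insertAt-punchIn z j 0ℚ b)) (M-trivial w Mw≡0 (punchIn j b)))
        where
        Mw≡0 : ∀ i → (M *ᵥ w) i ≡ 0ℚ
        Mw≡0 i with i ≟ᶠ r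
        ... | yes refl = Mwr≡0
        ... | no  i≢r  = offRow i i≢r

    -- β₂ w₁ - β₁ w₂ lies in the kernel of M, so isolating vectors are proportional.
    isolating-zero : ∀ {w₁ w₂ j} → Isolating w₁ → Isolating w₂ → w₂ j ≡ 0ℚ → w₁ j ≡ 0ℚ
    isolating-zero {w₁} {w₂} {j} (off₁ , _) (off₂ , β₂≢0) w₂j≡0 = p≢0⇒p*q≡0⇒q≡0 β₂≢0 (begin
      β₂ * w₁ j                 ≡⟨ solve 3 (λ a b x → a :* x := a :* x :- b :* con 0ℚ) refl β₂ β₁ (w₁ j) ⟩
      β₂ * w₁ j - β₁ * 0ℚ       ≡⟨ cong (λ y → β₂ * w₁ j - β₁ * y) (≡-sym w₂j≡0) ⟩
      v j                       ≡⟨ M-trivial v Mv≡0 j ⟩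
      0ℚ                        ∎)
      where
      open ≡-Reasoning
      β₁ = (M *ᵥ w₁) r
      β₂ = (M *ᵥ w₂) r
      v : Fin (suc n) → ℚ
      v t = β₂ * w₁ t - β₁ * w₂ t

      Mv≡0 : ∀ i → (M *ᵥ v) i ≡ 0ℚ
      Mv≡0 i with i ≟ᶠ r
      ... | yes refl = trans (*ᵥ-linear M β₂ β₁ w₁ w₂ r)
                             (solve 2 (λ a b → a :* b :- b :* a := con 0ℚ) refl β₂ β₁)
      ... | no  i≢r  = trans (*ᵥ-linear M β₂ β₁ w₁ w₂ i)
                             (trans (cong₂ (λ x y → β₂ * x - β₁ * y) (off₁ i i≢r) (off₂ i i≢r))
                                    (solve 2 (λ a b → a :* con 0ℚ :- b :* con 0ℚ := con 0ℚ) refl β₂ β₁))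

    nonzeroEntry⇒¬¬trivialMinor : ∀ {j₁} → M r j₁ ≢ 0ℚ →
                                  ¬ ¬ ∃ λ j → M r j ≢ 0ℚ × TrivialKernel (minor M r j)
    nonzeroEntry⇒¬¬trivialMinor Mrj₁≢0 none =
      isolatingAt Mrj₁≢0 λ (w₁ , iso₁ , _) →
      let (j₂ , Mrj₂w₁j₂≢0) = sumFin≢0⇒nonzeroTerm (λ t → M r t * w₁ t) (proj₂ iso₁) in
      isolatingAt (λ Mrj₂≡0 → Mrj₂w₁j₂≢0 (trans (cong (_* w₁ j₂) Mrj₂≡0) (*-zeroˡ (w₁ j₂))))
        λ (w₂ , iso₂ , w₂j₂≡0) →
      Mrj₂w₁j₂≢0 (trans (cong (M r j₂ *_) (isolating-zero {w₁} {w₂} iso₁ iso₂ w₂j₂≡0)) (*-zeroʳ (M r j₂)))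
      where
      isolatingAt : ∀ {j} → M r j ≢ 0ℚ → ¬ ¬ ∃ λ w → Isolating w × w j ≡ 0ℚ
      isolatingAt {j} Mrj≢0 = singularMinor⇒isolating <$>
        ¬trivialKernel⇒¬¬nontrivialKernel {M = minor M r j} (λ trivial → none (j , Mrj≢0 , trivial))

  extendTransversal : ∀ {n} (M : Matrix (suc n)) {r j} → M r j ≢ 0ℚ →
                      Transversal (minor M r j) → Transversal M
  extendTransversal M {r} {j} Mrj≢0 (τ , τ-inj , τ-nz) = σ , σ-inj , σ-nz
    where
    σ′ : ∀ v → Dec (v ≡ r) → Fin _
    σ′ v (yes _)   = j
    σ′ v (no  v≢r) = punchIn j (τ (punchOut (v≢r ∘ ≡-sym)))

    σ : Fin _ → Fin _
    σ v = σ′ v (v ≟ᶠ r)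

    σ′-inj : ∀ u v du dv → σ′ u du ≡ σ′ v dv → u ≡ v
    σ′-inj u v (yes u≡r) (yes v≡r) _  = trans u≡r (≡-sym v≡r)
    σ′-inj u v (yes _)   (no  _)   eq = contradiction (≡-sym eq) (punchInᵢ≢i j _)
    σ′-inj u v (no  _)   (yes _)   eq = contradiction eq (punchInᵢ≢i j _)
    σ′-inj u v (no  u≢r) (no  v≢r) eq =
      punchOut-injective (u≢r ∘ ≡-sym) (v≢r ∘ ≡-sym) (τ-inj (punchIn-injective j _ _ eq))

    σ-inj : Injective _≡_ _≡_ σ
    σ-inj {u} {v} = σ′-inj u v (u ≟ᶠ r) (v ≟ᶠ r)

    σ′-nz : ∀ v d → M v (σ′ v d) ≢ 0ℚ
    σ′-nz v (yes refl) = Mrj≢0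
    σ′-nz v (no  v≢r)  = subst (λ u → M u (σ′ v (no v≢r)) ≢ 0ℚ)
                               (punchIn-punchOut (v≢r ∘ ≡-sym)) (τ-nz _)

    σ-nz : ∀ v → M v (σ v) ≢ 0ℚ
    σ-nz v = σ′-nz v (v ≟ᶠ r)

  trivialKernel⇒nonzeroEntry : ∀ {n} (M : Matrix (suc n)) → TrivialKernel M → ∃₂ λ r j → M r j ≢ 0ℚ
  trivialKernel⇒nonzeroEntry M M-trivial with any? (λ r → any? (λ j → ¬? (M r j ≟ 0ℚ)))
  ... | yes found = found
  ... | no  none  = contradiction (M-trivial (λ _ → 1ℚ) M1≡0 fzero) λ ()
    where
    M1≡0 : ∀ i → (M *ᵥ (λ _ → 1ℚ)) i ≡ 0ℚ
    M1≡0 i = sumFin-zero λ j →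
      trans (cong (_* 1ℚ) (decidable-stable (M i j ≟ 0ℚ) λ Mij≢0 → none (i , j , Mij≢0))) (*-zeroˡ 1ℚ)

  trivialKernel⇒¬¬transversal : ∀ {n} (M : Matrix n) → TrivialKernel M → ¬ ¬ Transversal M
  trivialKernel⇒¬¬transversal {zero}  M _ = pure ((λ ()) , (λ { {()} }) , (λ ()))
  trivialKernel⇒¬¬transversal {suc n} M M-trivial = do
    let (r , j₁ , Mrj₁≢0) = trivialKernel⇒nonzeroEntry M M-trivial
    (j , Mrj≢0 , minor-trivial) ← nonzeroEntry⇒¬¬trivialMinor M M-trivial r Mrj₁≢0
    τ ← trivialKernel⇒¬¬transversal (minor M r j) minor-trivial
    pure (extendTransversal M Mrj≢0 τ)

module FiniteSearch where

  open import Data.Nat using (zero; suc)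
  open import Data.Fin using (Fin)
  open import Data.Fin.Properties using (any?)
  open import Data.Product using (_,_; ∃)
  open import Data.Vec.Functional using ([]; _∷_; head; tail)
  open import Data.Vec.Functional.Properties using (∷-cong)
  open import Function using (_∘_)
  open import Relation.Binary.PropositionalEquality using (_≗_; refl)
  open import Relation.Nullary using (Dec)
  open import Relation.Nullary.Decidable using (map′)

  ∃-function? : ∀ {n k} {P : (Fin n → Fin k) → Set} → (∀ {f g} → f ≗ g → P f → P g) →
                (∀ f → Dec (P f)) → Dec (∃ P)
  ∃-function? {zero} resp P? = map′ ([] ,_) (λ (f , p) → resp (λ ()) p) (P? [])
  ∃-function? {suc n} resp P? =
    map′ (λ (a , f , p) → a ∷ f , p)
         (λ (f , p) → head f , tail f , resp (∷-cong refl (λ _ → refl)) p)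
         (any? λ a → ∃-function? (resp ∘ ∷-cong refl) (P? ∘ (a ∷_)))

module Sequences where

  open import Data.Fin using (Fin; toℕ)
  open import Data.Fin.Properties using (toℕ-injective; toℕ<n; <⇒notInjective) renaming (_≟_ to _≟ᶠ_)
  open import Data.Nat using (zero; suc; _+_; _∸_; _<_)
  open import Data.Nat.Properties
    using (+-suc; +-mono-≤; +-monoʳ-<; +-cancelˡ-≡; <⇒≤; <⇒≱; ≰⇒>; n<1+n; m<1+n⇒m<n∨m≡n;
           m<n⇒0<n∸m; m+[n∸m]≡n; anyUpTo?)
  open import Data.Product using (_,_; ∃)
  open import Data.Sign using (Sign; opposite)
  open import Data.Sign.Properties using (s≢opposite[s]; opposite-involutive)
  open import Data.Sum using (_⊎_; inj₁; inj₂)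
  open import Function using (_∘_)
  open import Relation.Binary.Definitions using (DecidableEquality)
  open import Relation.Binary.PropositionalEquality
    using (_≡_; _≢_; refl; cong; trans; subst)
    renaming (sym to ≡-sym)
  open import Relation.Nullary using (yes; no; contradiction)

  data EvenOdd : ℕ → Set where
    even : ∀ q → EvenOdd (q + q)
    odd  : ∀ q → EvenOdd (suc (q + q))

  evenOdd : ∀ t → EvenOdd t
  evenOdd zero = even zero
  evenOdd (suc t) with evenOdd t
  ... | even q = odd q
  ... | odd  q = subst EvenOdd (cong suc (+-suc q q)) (even (suc q))

  half-< : ∀ {p d} → p + p < d + d → p < d
  half-< {p} {d} p+p<d+d = ≰⇒> λ d≤p → <⇒≱ p+p<d+d (+-mono-≤ d≤p d≤p)

  module _ {A : Set} where

    InjectiveBelow : ℕ → (ℕ → A) → Set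
    InjectiveBelow N s = ∀ {p q} → p < N → q < N → s p ≡ s q → p ≡ q

    record Loop (s : ℕ → A) : Set where
      field
        start    : ℕ
        length   : ℕ
        nonempty : 0 < length
        closed   : s (start + length) ≡ s start
        simple   : InjectiveBelow length (s ∘ (start +_))

    injectiveBelow⊎loop : DecidableEquality A → (s : ℕ → A) → ∀ N → InjectiveBelow N s ⊎ Loop s
    injectiveBelow⊎loop _≟_ s zero = inj₁ λ ()
    injectiveBelow⊎loop _≟_ s (suc N) with injectiveBelow⊎loop _≟_ s N
    ... | inj₂ loop = inj₂ loop
    ... | inj₁ inj with anyUpTo? (λ p → s p ≟ s N) N
    ...   | yes (p , p<N , sp≡sN) = inj₂ (record
      { start    = p
      ; length   = N ∸ p
      ; nonempty = m<n⇒0<n∸m p<N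
      ; closed   = trans (cong s p+[N∸p]≡N) (≡-sym sp≡sN)
      ; simple   = λ a<N∸p b<N∸p eq → +-cancelˡ-≡ p _ _ (inj (shift a<N∸p) (shift b<N∸p) eq)
      })
      where
      p+[N∸p]≡N = m+[n∸m]≡n (<⇒≤ p<N)
      shift : ∀ {a} → a < N ∸ p → p + a < N
      shift a<N∸p = subst (_ <_) p+[N∸p]≡N (+-monoʳ-< p a<N∸p)
    ...   | no fresh = inj₁ inj′
      where
      inj′ : InjectiveBelow (suc N) s
      inj′ {p} {q} p≤N q≤N eq with m<1+n⇒m<n∨m≡n p≤N | m<1+n⇒m<n∨m≡n q≤N
      ... | inj₁ p<N  | inj₁ q<N  = inj p<N q<N eq
      ... | inj₁ p<N  | inj₂ refl = contradiction (p , p<N , eq) fresh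
      ... | inj₂ refl | inj₁ q<N  = contradiction (q , q<N , ≡-sym eq) fresh
      ... | inj₂ refl | inj₂ refl = refl

    interleave : (ℕ → A) → (ℕ → A) → ℕ → A
    interleave f g zero    = f zero
    interleave f g (suc t) = interleave g (f ∘ suc) t

    interleave-even : ∀ f g q → interleave f g (q + q) ≡ f q
    interleave-even f g zero = refl
    interleave-even f g (suc q) rewrite +-suc q q = interleave-even (f ∘ suc) (g ∘ suc) q

    interleave-odd : ∀ f g q → interleave f g (suc (q + q)) ≡ g q
    interleave-odd f g = interleave-even g (f ∘ suc)

    interleave-step : ∀ (R : A → A → Set) {f g} → (∀ q → R (f q) (g q)) → (∀ q → R (g q) (f (suc q))) →
                      ∀ t → R (interleave f g t) (interleave f g (suc t))
    interleave-step R fRg gRf zero    = fRg zero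
    interleave-step R fRg gRf (suc t) = interleave-step R gRf (fRg ∘ suc) t

    interleave-injectiveBelow : ∀ {d} {f g : ℕ → A} → InjectiveBelow d f → InjectiveBelow d g →
                                (∀ p q → f p ≢ g q) → InjectiveBelow (d + d) (interleave f g)
    interleave-injectiveBelow {f = f} {g} f-inj g-inj f≢g {t} {t′} t<2d t′<2d eq
      with evenOdd t | evenOdd t′
    ... | even p | even q = cong (λ r → r + r) (f-inj (half-< t<2d) (half-< t′<2d)
      (trans (≡-sym (interleave-even f g p)) (trans eq (interleave-even f g q))))
    ... | odd p | odd q = cong (λ r → suc (r + r)) (g-inj (half-< (<⇒≤ t<2d)) (half-< (<⇒≤ t′<2d))
      (trans (≡-sym (interleave-odd f g p)) (trans eq (interleave-odd f g q))))
    ... | even p | odd q = contradiction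
      (trans (≡-sym (interleave-even f g p)) (trans eq (interleave-odd f g q))) (f≢g p q)
    ... | odd p | even q = contradiction
      (trans (≡-sym (interleave-even f g q)) (trans (≡-sym eq) (interleave-odd f g p))) (f≢g q p)

  loop : ∀ {n} (s : ℕ → Fin n) → Loop s
  loop {n} s with injectiveBelow⊎loop _≟ᶠ_ s (suc n)
  ... | inj₂ l   = l
  ... | inj₁ inj = contradiction (λ {i j} eq → toℕ-injective (inj (toℕ<n i) (toℕ<n j) eq))
                                 (<⇒notInjective {f = s ∘ toℕ} (n<1+n n))

  alternating⇒even : ∀ (σ : ℕ → Sign) → (∀ t → σ (suc t) ≡ opposite (σ t)) →
                     ∀ d → σ d ≡ σ 0 → ∃ λ k → d ≡ k + k
  alternating⇒even σ alt zero _ = zero , refl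
  alternating⇒even σ alt (suc zero) σ1≡σ0 = contradiction (trans (≡-sym σ1≡σ0) (alt 0)) (s≢opposite[s] (σ 0))
  alternating⇒even σ alt (suc (suc d)) σd+2≡σ0 =
    let (k , d≡k+k) = alternating⇒even σ alt d (trans (≡-sym σ-period) σd+2≡σ0)
    in suc k , cong suc (trans (cong suc d≡k+k) (≡-sym (+-suc k k)))
    where
    σ-period : σ (suc (suc d)) ≡ σ d
    σ-period = trans (trans (alt (suc d)) (cong opposite (alt d))) (opposite-involutive (σ d))

module GraphFacts {n} (G : SimpleGraph n) where

  open import Data.Bool using (Bool; true; false; not; if_then_else_)
  open import Data.Bool.Properties using (¬-not)
  open import Data.Fin using (Fin)
  open import Data.Rational using (0ℚ; 1ℚ)
  open import Relation.Binary.PropositionalEquality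
    using (_≡_; _≢_; refl; cong; trans) renaming (sym to ≡-sym)
  open import Relation.Nullary using (contradiction)

  Edge-sym : ∀ {u v} → Edge G u v → Edge G v u
  Edge-sym {u} {v} uv = trans (sym G v u) uv

  A-edge : ∀ {u v} → Edge G u v → A G u v ≡ 1ℚ
  A-edge = cong (if_then 1ℚ else 0ℚ)

  A≢0⇒edge : ∀ {u v} → A G u v ≢ 0ℚ → Edge G u v
  A≢0⇒edge {u} {v} Auv≢0 with adj G u v
  ... | true  = refl
  ... | false = contradiction refl Auv≢0

  colour-flips : ∀ {c : Fin n → Bool} → (∀ u v → Edge G u v → c u ≢ c v) →
                 ∀ {u v} → Edge G u v → c v ≡ not (c u)
  colour-flips bip {u} {v} uv = ¬-not (λ cv≡cu → bip u v uv (≡-sym cv≡cu))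

module NullVectors {n} (G : SimpleGraph n) where

  open import Data.Bool using (true; false)
  open import Data.Empty using (⊥-elim)
  open import Data.Fin using (Fin)
  open import Data.Product using (_,_; ∃; map₂)
  open import Data.Rational using (ℚ; _*_)
  open import Data.Rational.Properties using (*-identityˡ; *-zeroˡ)
  open import Data.Sign using (opposite)
  open import Relation.Binary.PropositionalEquality
    using (_≡_; refl; cong; trans; subst) renaming (sym to ≡-sym)
  open Signs
  open GraphFacts G

  hasSign-A* : ∀ {u w q} σ → HasSign σ (A G u w * q) → Edge G u w × HasSign σ q
  hasSign-A* {u} {w} {q} σ s with adj G u w
  ... | true  = refl , subst (HasSign σ) (*-identityˡ q) s
  ... | false = ⊥-elim (¬hasSign-0 σ (subst (HasSign σ) (*-zeroˡ q) s))

  nullVector-step : ∀ {x : Fin n → ℚ} {u v σ} → InNull G x → Edge G u v → HasSign σ (x v) →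
                    ∃ λ w → Edge G u w × HasSign (opposite σ) (x w)
  nullVector-step {x} {u} {v} {σ} x-null uv xv =
    map₂ (hasSign-A* (opposite σ)) (sumFin≡0⇒oppositeSign (x-null u) (subst (HasSign σ) (≡-sym Auv*xv≡xv) xv))
    where
    Auv*xv≡xv : A G u v * x v ≡ x v
    Auv*xv≡xv = trans (cong (_* x v) (A-edge uv)) (*-identityˡ (x v))

module AlternatingWalks where

  open import Data.Bool using (Bool; not)
  open import Data.Bool.Properties using (not-involutive)
  open import Data.Fin using (Fin; toℕ)
  open import Data.Fin.Properties using (toℕ-injective; toℕ<n)
  open import Data.Nat using (zero; suc; _+_; _*_; _≤_; _<_; _≥_; z≤n; s≤s)
  open import Data.Nat.Properties using (+-suc; +-identityʳ; *-monoʳ-≤; ≤-trans)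
  open import Data.Nat.Solver using (module +-*-Solver)
  open import Data.Product using (_,_; proj₁; proj₂; ∃)
  open import Data.Rational using (ℚ; 0ℚ)
  import Data.Rational.Properties as ℚ
  open import Data.Sign using (Sign; opposite)
  open import Function using (_∘_)
  open import Relation.Binary.PropositionalEquality
    using (_≡_; _≢_; refl; cong; trans; subst; subst₂) renaming (sym to ≡-sym)
  open import Relation.Nullary using (contradiction)
  open import Relation.Nullary.Decidable using (decidable-stable)
  open Signs using (HasSign; hasSign-functional; ≢0⇒hasSign)
  open Sequences
  open +-*-Solver

  closedWalk⇒cycle : ∀ {n} (G : SimpleGraph n) (g : ℕ → Fin n) {L} → 3 ≤ L → InjectiveBelow L g →
                     (∀ t → Edge G (g t) (g (suc t))) → g L ≡ g 0 → HasCycleOfLength G L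
  closedWalk⇒cycle G g {suc L} 3≤L g-inj g-edge closed =
    3≤L , g ∘ toℕ , (λ eq → toℕ-injective (g-inj (toℕ<n _) (toℕ<n _) eq)) , step , close
    where
    step : ∀ i j → suc (toℕ i) ≡ toℕ j → Edge G (g (toℕ i)) (g (toℕ j))
    step i j eq = subst (Edge G (g (toℕ i)) ∘ g) eq (g-edge (toℕ i))

    close : ∀ i j → toℕ i ≡ L → toℕ j ≡ 0 → Edge G (g (toℕ i)) (g (toℕ j))
    close i j i≡L j≡0 = subst₂ (λ a b → Edge G (g a) (g b)) (≡-sym i≡L) (≡-sym j≡0)
                               (subst (Edge G (g L)) closed (g-edge L))

  module _ {n} (G : SimpleGraph n) {c : Fin n → Bool} (bip : ∀ u v → Edge G u v → c u ≢ c v)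
           {m : Fin n → Fin n} (m-edge : ∀ v → Edge G v (m v)) (m-involutive : ∀ v → m (m v) ≡ v)
           {x : Fin n → ℚ} (x-null : InNull G x) where

    open GraphFacts G
    open NullVectors G

    record SignedVertex : Set where
      field
        sign    : Sign
        vertex  : Fin n
        hasSign : HasSign sign (x vertex)
    open SignedVertex

    step : ∀ p → ∃ λ w → Edge G (m (vertex p)) w × HasSign (opposite (sign p)) (x w)
    step p = nullVector-step x-null (Edge-sym (m-edge (vertex p))) (hasSign p)

    next : SignedVertex → SignedVertex
    next p = record { sign = opposite (sign p) ; vertex = proj₁ (step p) ; hasSign = proj₂ (proj₂ (step p)) }

    m-injective : ∀ {u v} → m u ≡ m v → u ≡ v
    m-injective {u} {v} eq = trans (≡-sym (m-involutive u)) (trans (cong m eq) (m-involutive v))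

    module _ (origin : SignedVertex) where

      walk : ℕ → SignedVertex
      walk zero    = origin
      walk (suc t) = next (walk t)

      s : ℕ → Fin n
      s = vertex ∘ walk

      s-edge : ∀ t → Edge G (m (s t)) (s (suc t))
      s-edge t = proj₁ (proj₂ (step (walk t)))

      s-colour : ∀ t → c (s t) ≡ c (s 0)
      s-colour zero    = refl
      s-colour (suc t) = trans (colour-flips bip (s-edge t))
        (trans (cong not (colour-flips bip (m-edge (s t)))) (trans (not-involutive _) (s-colour t)))

      sign-determined : ∀ {i j} → s i ≡ s j → sign (walk i) ≡ sign (walk j)
      sign-determined {i} {j} eq =
        hasSign-functional (subst (HasSign (sign (walk i)) ∘ x) eq (hasSign (walk i))) (hasSign (walk j))

      alternatingCycle : ∃ λ k → k ≥ 1 × HasCycleOfLength G (4 * k)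
      alternatingCycle = k , 1≤k , subst (HasCycleOfLength G) (≡-sym 4k≡2d) cycle
        where
        open Loop (loop s)

        f : ℕ → Fin n
        f = s ∘ (start +_)

        length-even : ∃ λ k → length ≡ k + k
        length-even = alternating⇒even (sign ∘ walk ∘ (start +_)) (cong (sign ∘ walk) ∘ +-suc start) length
          (trans (sign-determined {start + length} {start} closed) (cong (sign ∘ walk) (≡-sym (+-identityʳ start))))

        k = proj₁ length-even

        1≤k : 1 ≤ k
        1≤k with k | proj₂ length-even
        ... | zero  | length≡0 = contradiction (subst (0 <_) length≡0 nonempty) λ ()
        ... | suc _ | _        = s≤s z≤n

        4k≡2d : 4 * k ≡ length + length
        4k≡2d = trans (solve 1 (λ k → con 4 :* k := (k :+ k) :+ (k :+ k)) refl k)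
                      (≡-sym (cong (λ d → d + d) (proj₂ length-even)))

        f≢mf : ∀ p q → f p ≢ m (f q)
        f≢mf p q eq = bip (f q) (m (f q)) (m-edge (f q))
          (trans (trans (s-colour (start + q)) (≡-sym (s-colour (start + p)))) (cong c eq))

        cycle : HasCycleOfLength G (length + length)
        cycle = closedWalk⇒cycle G (interleave f (m ∘ f))
          (subst (3 ≤_) 4k≡2d (≤-trans (s≤s (s≤s (s≤s z≤n))) (*-monoʳ-≤ 4 1≤k)))
          (interleave-injectiveBelow simple (λ p q → simple p q ∘ m-injective) f≢mf)
          (interleave-step (Edge G) (m-edge ∘ f)
            (λ q → subst (Edge G (m (f q)) ∘ s) (≡-sym (+-suc start q)) (s-edge (start + q))))
          (trans (interleave-even f (m ∘ f) length)
                 (trans closed (cong s (≡-sym (+-identityʳ start)))))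

  perfectMatching⇒nonsingular : ∀ {n} (G : SimpleGraph n) → Bipartite G → C4kFree G →
                                HasPerfectMatching G → Nonsingular G
  perfectMatching⇒nonsingular G (c , bip) c4k-free (m , m-edge , m-involutive) x x-null v =
    decidable-stable (x v ℚ.≟ 0ℚ) λ xv≢0 →
      let (σ , xv-sign) = ≢0⇒hasSign xv≢0
          (k , k≥1 , cycle) = alternatingCycle G bip m-edge m-involutive x-null
                                (record { sign = σ ; vertex = v ; hasSign = xv-sign })
      in c4k-free k k≥1 cycle

module Matchings where

  open import Data.Bool using (Bool; true; false; not)
  import Data.Bool.Properties as Bool
  open import Data.Fin using (Fin; punchOut)
  open import Data.Fin.Properties using (any?; all?; punchOut-injective; <⇒notInjective) renaming (_≟_ to _≟ᶠ_)
  open import Data.Nat using (suc)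
  open import Data.Nat.Properties using (n<1+n)
  open import Data.Product using (_×_; _,_; proj₁; proj₂; ∃)
  open import Function using (_∘_)
  open import Function.Definitions using (Injective)
  open import Relation.Binary.PropositionalEquality
    using (_≡_; _≢_; _≗_; cong; trans; subst) renaming (sym to ≡-sym)
  open import Relation.Nullary using (Dec; yes; no; contradiction; _×-dec_)
  open import Relation.Nullary.Decidable using (decidable-stable)
  open import Relation.Nullary.Negation using (¬¬-map)
  open Matrices using (Transversal; trivialKernel⇒¬¬transversal)
  open FiniteSearch using (∃-function?)

  injective⇒surjective : ∀ {n} {σ : Fin n → Fin n} → Injective _≡_ _≡_ σ → ∀ v → ∃ λ u → σ u ≡ v
  injective⇒surjective {suc n} {σ} σ-inj v with any? (λ u → σ u ≟ᶠ v)
  ... | yes found = found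
  ... | no  missed = contradiction (λ {u₁ u₂} eq → σ-inj (punchOut-injective (miss u₁) (miss u₂) eq))
                                   (<⇒notInjective {f = λ u → punchOut (miss u)} (n<1+n n))
    where
    miss : ∀ u → v ≢ σ u
    miss u v≡σu = missed (u , ≡-sym v≡σu)

  module _ {n} (G : SimpleGraph n) where

    open GraphFacts G

    transversal⇒perfectMatching : Bipartite G → Transversal (A G) → HasPerfectMatching G
    transversal⇒perfectMatching (c , bip) (σ , σ-inj , σ-nz) = match , match-edge , match-involutive
      where
      σ⁻¹ : Fin n → Fin n
      σ⁻¹ = proj₁ ∘ injective⇒surjective σ-inj

      σ∘σ⁻¹ : ∀ v → σ (σ⁻¹ v) ≡ v
      σ∘σ⁻¹ = proj₂ ∘ injective⇒surjective σ-inj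

      σ-edge : ∀ v → Edge G v (σ v)
      σ-edge v = A≢0⇒edge (σ-nz v)

      partner : Bool → Fin n → Fin n
      partner true  = σ
      partner false = σ⁻¹

      partner-edge : ∀ b v → Edge G v (partner b v)
      partner-edge true  v = σ-edge v
      partner-edge false v = Edge-sym (subst (Edge G (σ⁻¹ v)) (σ∘σ⁻¹ v) (σ-edge (σ⁻¹ v)))

      partner-not : ∀ b v → partner (not b) (partner b v) ≡ v
      partner-not true  v = σ-inj (σ∘σ⁻¹ (σ v))
      partner-not false v = σ∘σ⁻¹ v

      match : Fin n → Fin n
      match v = partner (c v) v

      match-edge : ∀ v → Edge G v (match v)
      match-edge v = partner-edge (c v) v

      match-involutive : ∀ v → match (match v) ≡ v
      match-involutive v =
        trans (cong (λ b → partner b (match v)) (colour-flips bip (match-edge v))) (partner-not (c v) v)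

    IsPerfectMatching : (Fin n → Fin n) → Set
    IsPerfectMatching m = (∀ v → Edge G v (m v)) × (∀ v → m (m v) ≡ v)

    isPerfectMatching-resp : ∀ {m m′} → m ≗ m′ → IsPerfectMatching m → IsPerfectMatching m′
    isPerfectMatching-resp {m} {m′} m≗m′ (m-edge , m-involutive) =
      (λ v → subst (Edge G v) (m≗m′ v) (m-edge v)) ,
      (λ v → trans (cong m′ (≡-sym (m≗m′ v))) (trans (≡-sym (m≗m′ (m v))) (m-involutive v)))

    hasPerfectMatching? : Dec (HasPerfectMatching G)
    hasPerfectMatching? = ∃-function? isPerfectMatching-resp λ m →
      all? (λ v → adj G v (m v) Bool.≟ true) ×-dec all? (λ v → m (m v) ≟ᶠ v)

    nonsingular⇒perfectMatching : Bipartite G → Nonsingular G → HasPerfectMatching G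
    nonsingular⇒perfectMatching bip ns = decidable-stable hasPerfectMatching?
      (¬¬-map (transversal⇒perfectMatching bip) (trivialKernel⇒¬¬transversal (A G) ns))

module Support {n} (G : SimpleGraph n) where

  open import Data.Product using (_,_; proj₁)
  open import Data.Rational using (0ℚ)
  open import Data.Rational.Properties using (_≟_)
  open import Relation.Nullary using (¬_)
  open import Relation.Nullary.Decidable using (decidable-stable)

  nonsingular⇒¬supp : Nonsingular G → ∀ v → ¬ InSupp G v
  nonsingular⇒¬supp ns v (x , x-null , xv≢0) = xv≢0 (ns x x-null v)

  nonsingular⇒equalsCN : Nonsingular G → EqualsCN G
  nonsingular⇒equalsCN ns v = nonsingular⇒¬supp ns v , λ (u , u-supp , _) → nonsingular⇒¬supp ns u u-supp

  equalsCN⇒nonsingular : EqualsCN G → Nonsingular G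
  equalsCN⇒nonsingular cn x x-null v = decidable-stable (x v ≟ 0ℚ) λ xv≢0 → proj₁ (cn v) (x , x-null , xv≢0)

open AlternatingWalks using (perfectMatching⇒nonsingular)
open Matchings using (nonsingular⇒perfectMatching)
open Support using (nonsingular⇒equalsCN; equalsCN⇒nonsingular)

corollary4p1 : ∀ (n : ℕ) (G : SimpleGraph n) → C4kFreeBipartite G →
    (HasPerfectMatching G ⇔ Nonsingular G) × (Nonsingular G ⇔ EqualsCN G)
corollary4p1 n G (bip , c4k-free) =
  mk⇔ (perfectMatching⇒nonsingular G bip c4k-free) (nonsingular⇒perfectMatching G bip) ,
  mk⇔ (nonsingular⇒equalsCN G) (equalsCN⇒nonsingular G)
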